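{- There exist an IZF${}_R$ formula $\phi$ and a $\lambda Z$ term $M$ such that $\vdash M:\phi$ (empty context) and $M$ does not strongly normalize, i.e. there is an infinite sequence of full reduction steps starting from $M$.
   Context: IZF${}_R$ language: intuitionistic first-order logic without equality; one binary relation symbol $\in$; terms are variables, $\emptyset$, $\omega$, $\{t,u\}$, $\bigcup t$, $P(t)$, $S_{\phi(a,\vec f)}(t,\vec u)$, $R_{\phi(a,b,\vec f)}(t,\vec u)$ (one symbol per formula $\phi$), formulas built from $t\in u$ and $\bot$ with $\land,\lor,\to,\forall,\exists$; $t=u$ abbreviates $\forall z.\ z\in t\leftrightarrow z\in u$, $0:=\emptyset$, $S(t):=\bigcup\{t,\{t,t\}\}$. The class axioms have the form $\forall\vec a\,\forall c.\ c\in t_A(\vec a)\leftrightarrow\phi_A(c,\vec a)$: (EMPTY) $\emptyset$, $\bot$; (PAIR) $\{a,b\}$, $c=a\lor c=b$; (INF) $\omega$, $c=0\lor\exists b\in\omega.\ c=S(b)$; (SEP${}_\phi$) $S_{\phi(a,\vec f)}(a,\vec f)$, $c\in a\land\phi(c,\vec f)$; (UNION) $\bigcup a$, $\exists b\in a.\ c\in b$; (POWER) $P(a)$, $\forall b.\ b\in c\to b\in a$; (REPL${}_\phi$) $R_{\phi(a,b,\vec f)}(a,\vec f)$, $(\forall x\in a\,\exists!y.\ \phi(x,y,\vec f))\land\exists x\in a.\ \phi(x,c,\vec f)$; with names ax $\in\{$empty, pair, inf, sep${}_\phi$, union, power, repl${}_\phi\}$. $\lambda Z$ terms ($x$ proof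 variables, $a$ first-order variables, $t,u$ IZF${}_R$ terms; modulo $\alpha$): $M ::= x\mid M\,N\mid\lambda a.M\mid\lambda x:\phi.M\mid\mathrm{inl}(M)\mid\mathrm{inr}(M)\mid\mathrm{fst}(M)\mid\mathrm{snd}(M)\mid[t,M]\mid M\,t\mid\langle M,N\rangle\mid\mathrm{case}(M,x:\phi.N,x:\psi.O)\mid\mathrm{magic}(M)\mid\mathrm{let}\ [a,x:\phi]:=M\ \mathrm{in}\ N\mid\mathrm{axRep}(t,\vec u,M)\mid\mathrm{axProp}(t,\vec u,M)\mid\mathrm{ind}_{\phi(a,\vec b)}(\vec t,M)$. Base reduction rules: $(\lambda x:\phi.M)N\to M[x:=N]$; $(\lambda a.M)t\to M[a:=t]$; $\mathrm{fst}\langle M,N\rangle\to M$; $\mathrm{snd}\langle M,N\rangle\to N$; $\mathrm{case}(\mathrm{inl}(M),x:\phi.N,x:\psi.O)\to N[x:=M]$; $\mathrm{case}(\mathrm{inr}(M),x:\phi.N,x:\psi.O)\to O[x:=M]$; $\mathrm{let}\ [a,x:\phi]:=[t,M]\ \mathrm{in}\ N\to N[a:=t][x:=M]$; $\mathrm{axProp}(t,\vec u,\mathrm{axRep}(t,\vec u,M))\to M$; $\mathrm{ind}_{\phi(a,\vec b)}(\vec t,M)\to\lambda c.\ M\,c\,(\lambda b.\lambda x:b\in c.\ \mathrm{ind}_{\phi(a,\vec b)}(\vec t,M)\,b)$ ($c,b,x$ fresh). Full (non-deterministic) reduction: a base rule may be applied to any subterm, anywhere inside a term (including under binders). A term strongly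 normalizes if every full reduction path starting from it is finite. Typing ($\Gamma$ finite set of declarations $x:\phi$): the natural-deduction rules of intuitionistic first-order logic annotated with these terms (variable; $\lambda x:\phi$ introduces $\to$ and application eliminates it; $\langle\cdot,\cdot\rangle$, fst, snd for $\land$; inl, inr, case for $\lor$; $\lambda a$ (with $a$ not free in $\Gamma$) and $M\,t$ for $\forall$; $[t,M]$ and let (with $a$ not free in $\Gamma,\psi$) for $\exists$; magic for $\bot$), plus: from $M:\phi_A(t,\vec u)$ infer $\mathrm{axRep}(t,\vec u,M):t\in t_A(\vec u)$; from $M:t\in t_A(\vec u)$ infer $\mathrm{axProp}(t,\vec u,M):\phi_A(t,\vec u)$; from $M:\forall c.(\forall b.\ b\in c\to\phi(b,\vec t))\to\phi(c,\vec t)$ infer $\mathrm{ind}_{\phi(a,\vec f)}(\vec t,M):\forall a.\phi(a,\vec t)$. -}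

module Defs where

-- Term n / Formula n : IZF_R terms / formulas whose free first-order variables
-- are among the n variables  var zero , ... , var (n-1)  (var zero = innermost binder).
-- PTerm n m : lambda-Z proof terms with n free first-order variables and m free
-- proof variables.  Working with de Bruijn indices is "modulo alpha".

open import Data.Nat using (ℕ; zero; suc)
open import Data.Fin using (Fin; zero; suc)
open import Data.Vec using (Vec; []; _∷_; lookup)
open import Data.Product using (Σ; _×_; _,_)
open import Relation.Binary.PropositionalEquality using (_≡_)

infixr 6 _∧'_
infixr 5 _∨'_
infixr 4 _⇒'_
infix 7 _∈'_

mutual
  data Term (n : ℕ) : Set where
    var   : Fin n → Term n
    ∅'    : Term n
    ω'    : Term n
    ⟦_,_⟧ : Term n → Term n → Term n
    ⋃'    : Term n → Term n
    𝒫'    : Term n → Term n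
    -- S_{φ(a,f⃗)}(t,u⃗) : φ has free variables among a (= var zero) and
    -- f_0 .. f_{k-1} (= var (suc i))
    Sep   : ∀ {k} → Formula (suc k) → Term n → Vec (Term n) k → Term n
    -- R_{φ(a,b,f⃗)}(t,u⃗) : a = var 0, b = var 1, f_i = var (2+i)
    Rep   : ∀ {k} → Formula (suc (suc k)) → Term n → Vec (Term n) k → Term n

  data Formula (n : ℕ) : Set where
    _∈'_ : Term n → Term n → Formula n
    ⊥'   : Formula n
    _∧'_ _∨'_ _⇒'_ : Formula n → Formula n → Formula n
    ∀' ∃' : Formula (suc n) → Formula n

Ren : ℕ → ℕ → Set
Ren n n' = Fin n → Fin n'

ext : ∀ {n n'} → Ren n n' → Ren (suc n) (suc n')
ext ρ zero = zero
ext ρ (suc i) = suc (ρ i)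

mutual
  renT : ∀ {n n'} → Ren n n' → Term n → Term n'
  renT ρ (var x) = var (ρ x)
  renT ρ ∅' = ∅'
  renT ρ ω' = ω'
  renT ρ ⟦ t , u ⟧ = ⟦ renT ρ t , renT ρ u ⟧
  renT ρ (⋃' t) = ⋃' (renT ρ t)
  renT ρ (𝒫' t) = 𝒫' (renT ρ t)
  renT ρ (Sep φ t us) = Sep φ (renT ρ t) (renTs ρ us)
  renT ρ (Rep φ t us) = Rep φ (renT ρ t) (renTs ρ us)

  renTs : ∀ {n n' k} → Ren n n' → Vec (Term n) k → Vec (Term n') k
  renTs ρ [] = []
  renTs ρ (t ∷ ts) = renT ρ t ∷ renTs ρ ts

  renF : ∀ {n n'} → Ren n n' → Formula n → Formula n'
  renF ρ (t ∈' u) = renT ρ t ∈' renT ρ u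
  renF ρ ⊥' = ⊥'
  renF ρ (φ ∧' ψ) = renF ρ φ ∧' renF ρ ψ
  renF ρ (φ ∨' ψ) = renF ρ φ ∨' renF ρ ψ
  renF ρ (φ ⇒' ψ) = renF ρ φ ⇒' renF ρ ψ
  renF ρ (∀' φ) = ∀' (renF (ext ρ) φ)
  renF ρ (∃' φ) = ∃' (renF (ext ρ) φ)

Sub : ℕ → ℕ → Set
Sub n n' = Fin n → Term n'

wkT : ∀ {n} → Term n → Term (suc n)
wkT = renT suc

wkTs : ∀ {n k} → Vec (Term n) k → Vec (Term (suc n)) k
wkTs = renTs suc

wkF : ∀ {n} → Formula n → Formula (suc n)
wkF = renF suc

exts : ∀ {n n'} → Sub n n' → Sub (suc n) (suc n')
exts σ zero = var zero
exts σ (suc i) = wkT (σ i)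

mutual
  subT : ∀ {n n'} → Sub n n' → Term n → Term n'
  subT σ (var x) = σ x
  subT σ ∅' = ∅'
  subT σ ω' = ω'
  subT σ ⟦ t , u ⟧ = ⟦ subT σ t , subT σ u ⟧
  subT σ (⋃' t) = ⋃' (subT σ t)
  subT σ (𝒫' t) = 𝒫' (subT σ t)
  subT σ (Sep φ t us) = Sep φ (subT σ t) (subTs σ us)
  subT σ (Rep φ t us) = Rep φ (subT σ t) (subTs σ us)

  subTs : ∀ {n n' k} → Sub n n' → Vec (Term n) k → Vec (Term n') k
  subTs σ [] = []
  subTs σ (t ∷ ts) = subT σ t ∷ subTs σ ts

  subF : ∀ {n n'} → Sub n n' → Formula n → Formula n'
  subF σ (t ∈' u) = subT σ t ∈' subT σ u
  subF σ ⊥' = ⊥'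
  subF σ (φ ∧' ψ) = subF σ φ ∧' subF σ ψ
  subF σ (φ ∨' ψ) = subF σ φ ∨' subF σ ψ
  subF σ (φ ⇒' ψ) = subF σ φ ⇒' subF σ ψ
  subF σ (∀' φ) = ∀' (subF (exts σ) φ)
  subF σ (∃' φ) = ∃' (subF (exts σ) φ)

sub0 : ∀ {n} → Term n → Sub (suc n) n
sub0 t zero = t
sub0 t (suc i) = var i

_[_]F : ∀ {n} → Formula (suc n) → Term n → Formula n
φ [ t ]F = subF (sub0 t) φ

inst1 : ∀ {n k} → Term n → Vec (Term n) k → Sub (suc k) n
inst1 t us zero = t
inst1 t us (suc i) = lookup us i

inst2 : ∀ {n k} → Term n → Term n → Vec (Term n) k → Sub (suc (suc k)) n
inst2 t s us zero = t
inst2 t s us (suc zero) = s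
inst2 t s us (suc (suc i)) = lookup us i

_⇔'_ : ∀ {n} → Formula n → Formula n → Formula n
φ ⇔' ψ = (φ ⇒' ψ) ∧' (ψ ⇒' φ)

_≐_ : ∀ {n} → Term n → Term n → Formula n
t ≐ u = ∀' ((var zero ∈' wkT t) ⇔' (var zero ∈' wkT u))

zero' : ∀ {n} → Term n
zero' = ∅'

S' : ∀ {n} → Term n → Term n
S' t = ⋃' ⟦ t , ⟦ t , t ⟧ ⟧

∃∈ : ∀ {n} → Term n → Formula (suc n) → Formula n
∃∈ t φ = ∃' ((var zero ∈' wkT t) ∧' φ)

∀∈ : ∀ {n} → Term n → Formula (suc n) → Formula n
∀∈ t φ = ∀' ((var zero ∈' wkT t) ⇒' φ)

∃!' : ∀ {n} → Formula (suc n) → Formula n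
∃!' φ = ∃' (φ ∧' ∀' (renF (ext suc) φ ⇒' (var (suc zero) ≐ var zero)))

-- Axioms: names, class terms t_A and defining formulas φ_A
-- Ax k : axiom names whose class term takes k arguments

data Ax : ℕ → Set where
  ax-empty : Ax 0
  ax-pair  : Ax 2
  ax-inf   : Ax 0
  ax-sep   : ∀ {k} → Formula (suc k) → Ax (suc k)
  ax-union : Ax 1
  ax-power : Ax 1
  ax-repl  : ∀ {k} → Formula (suc (suc k)) → Ax (suc k)

tA : ∀ {n k} → Ax k → Vec (Term n) k → Term n
tA ax-empty [] = ∅'
tA ax-pair (a ∷ b ∷ []) = ⟦ a , b ⟧
tA ax-inf [] = ω'
tA (ax-sep φ) (a ∷ fs) = Sep φ a fs
tA ax-union (a ∷ []) = ⋃' a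
tA ax-power (a ∷ []) = 𝒫' a
tA (ax-repl φ) (a ∷ fs) = Rep φ a fs

φA : ∀ {n k} → Ax k → Term n → Vec (Term n) k → Formula n
φA ax-empty c [] = ⊥'
φA ax-pair c (a ∷ b ∷ []) = (c ≐ a) ∨' (c ≐ b)
φA ax-inf c [] = (c ≐ zero') ∨' ∃∈ ω' (wkT c ≐ S' (var zero))
φA (ax-sep φ) c (a ∷ fs) = (c ∈' a) ∧' subF (inst1 c fs) φ
φA ax-union c (a ∷ []) = ∃∈ a (wkT c ∈' var zero)
φA ax-power c (a ∷ []) = ∀' ((var zero ∈' wkT c) ⇒' (var zero ∈' wkT a))
φA (ax-repl φ) c (a ∷ fs) =
  ∀∈ a (∃!' (subF (inst2 (var (suc zero)) (var zero) (wkTs (wkTs fs))) φ))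
  ∧' ∃∈ a (subF (inst2 (var zero) (wkT c) (wkTs fs)) φ)

data PTerm (n m : ℕ) : Set where
  pvar   : Fin m → PTerm n m
  app    : PTerm n m → PTerm n m → PTerm n m
  Λ      : PTerm (suc n) m → PTerm n m
  ƛ      : Formula n → PTerm n (suc m) → PTerm n m
  inl    : PTerm n m → PTerm n m
  inr    : PTerm n m → PTerm n m
  fst    : PTerm n m → PTerm n m
  snd    : PTerm n m → PTerm n m
  pack   : Term n → PTerm n m → PTerm n m
  appT   : PTerm n m → Term n → PTerm n m
  ⟨_,_⟩  : PTerm n m → PTerm n m → PTerm n m
  case   : PTerm n m → Formula n → PTerm n (suc m)
           → Formula n → PTerm n (suc m) → PTerm n m
  magic  : PTerm n m → PTerm n m
  unpack : Formula (suc n) → PTerm n m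
           → PTerm (suc n) (suc m) → PTerm n m
  axRep  : ∀ {k} → Ax k → Term n → Vec (Term n) k → PTerm n m → PTerm n m
  axProp : ∀ {k} → Ax k → Term n → Vec (Term n) k → PTerm n m → PTerm n m
  ind    : ∀ {k} → Formula (suc k) → Vec (Term n) k → PTerm n m → PTerm n m

renP : ∀ {n n' m} → Ren n n' → PTerm n m → PTerm n' m
renP ρ (pvar x) = pvar x
renP ρ (app M N) = app (renP ρ M) (renP ρ N)
renP ρ (Λ M) = Λ (renP (ext ρ) M)
renP ρ (ƛ φ M) = ƛ (renF ρ φ) (renP ρ M)
renP ρ (inl M) = inl (renP ρ M)
renP ρ (inr M) = inr (renP ρ M)
renP ρ (fst M) = fst (renP ρ M)
renP ρ (snd M) = snd (renP ρ M)
renP ρ (pack t M) = pack (renT ρ t) (renP ρ M)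
renP ρ (appT M t) = appT (renP ρ M) (renT ρ t)
renP ρ ⟨ M , N ⟩ = ⟨ renP ρ M , renP ρ N ⟩
renP ρ (case M φ N ψ O) = case (renP ρ M) (renF ρ φ) (renP ρ N) (renF ρ ψ) (renP ρ O)
renP ρ (magic M) = magic (renP ρ M)
renP ρ (unpack φ M N) = unpack (renF (ext ρ) φ) (renP ρ M) (renP (ext ρ) N)
renP ρ (axRep A t us M) = axRep A (renT ρ t) (renTs ρ us) (renP ρ M)
renP ρ (axProp A t us M) = axProp A (renT ρ t) (renTs ρ us) (renP ρ M)
renP ρ (ind φ ts M) = ind φ (renTs ρ ts) (renP ρ M)

subP : ∀ {n n' m} → Sub n n' → PTerm n m → PTerm n' m
subP σ (pvar x) = pvar x
subP σ (app M N) = app (subP σ M) (subP σ N)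
subP σ (Λ M) = Λ (subP (exts σ) M)
subP σ (ƛ φ M) = ƛ (subF σ φ) (subP σ M)
subP σ (inl M) = inl (subP σ M)
subP σ (inr M) = inr (subP σ M)
subP σ (fst M) = fst (subP σ M)
subP σ (snd M) = snd (subP σ M)
subP σ (pack t M) = pack (subT σ t) (subP σ M)
subP σ (appT M t) = appT (subP σ M) (subT σ t)
subP σ ⟨ M , N ⟩ = ⟨ subP σ M , subP σ N ⟩
subP σ (case M φ N ψ O) = case (subP σ M) (subF σ φ) (subP σ N) (subF σ ψ) (subP σ O)
subP σ (magic M) = magic (subP σ M)
subP σ (unpack φ M N) = unpack (subF (exts σ) φ) (subP σ M) (subP (exts σ) N)
subP σ (axRep A t us M) = axRep A (subT σ t) (subTs σ us) (subP σ M)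
subP σ (axProp A t us M) = axProp A (subT σ t) (subTs σ us) (subP σ M)
subP σ (ind φ ts M) = ind φ (subTs σ ts) (subP σ M)

pext : ∀ {m m'} → Ren m m' → Ren (suc m) (suc m')
pext = ext

renPP : ∀ {n m m'} → Ren m m' → PTerm n m → PTerm n m'
renPP ρ (pvar x) = pvar (ρ x)
renPP ρ (app M N) = app (renPP ρ M) (renPP ρ N)
renPP ρ (Λ M) = Λ (renPP ρ M)
renPP ρ (ƛ φ M) = ƛ φ (renPP (ext ρ) M)
renPP ρ (inl M) = inl (renPP ρ M)
renPP ρ (inr M) = inr (renPP ρ M)
renPP ρ (fst M) = fst (renPP ρ M)
renPP ρ (snd M) = snd (renPP ρ M)
renPP ρ (pack t M) = pack t (renPP ρ M)
renPP ρ (appT M t) = appT (renPP ρ M) t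
renPP ρ ⟨ M , N ⟩ = ⟨ renPP ρ M , renPP ρ N ⟩
renPP ρ (case M φ N ψ O) = case (renPP ρ M) φ (renPP (ext ρ) N) ψ (renPP (ext ρ) O)
renPP ρ (magic M) = magic (renPP ρ M)
renPP ρ (unpack φ M N) = unpack φ (renPP ρ M) (renPP (ext ρ) N)
renPP ρ (axRep A t us M) = axRep A t us (renPP ρ M)
renPP ρ (axProp A t us M) = axProp A t us (renPP ρ M)
renPP ρ (ind φ ts M) = ind φ ts (renPP ρ M)

PSub : ℕ → ℕ → ℕ → Set
PSub n m m' = Fin m → PTerm n m'

pexts : ∀ {n m m'} → PSub n m m' → PSub n (suc m) (suc m')
pexts σ zero = pvar zero
pexts σ (suc i) = renPP suc (σ i)

fexts : ∀ {n m m'} → PSub n m m' → PSub (suc n) m m'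
fexts σ i = renP suc (σ i)

subPP : ∀ {n m m'} → PSub n m m' → PTerm n m → PTerm n m'
subPP σ (pvar x) = σ x
subPP σ (app M N) = app (subPP σ M) (subPP σ N)
subPP σ (Λ M) = Λ (subPP (fexts σ) M)
subPP σ (ƛ φ M) = ƛ φ (subPP (pexts σ) M)
subPP σ (inl M) = inl (subPP σ M)
subPP σ (inr M) = inr (subPP σ M)
subPP σ (fst M) = fst (subPP σ M)
subPP σ (snd M) = snd (subPP σ M)
subPP σ (pack t M) = pack t (subPP σ M)
subPP σ (appT M t) = appT (subPP σ M) t
subPP σ ⟨ M , N ⟩ = ⟨ subPP σ M , subPP σ N ⟩
subPP σ (case M φ N ψ O) = case (subPP σ M) φ (subPP (pexts σ) N) ψ (subPP (pexts σ) O)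
subPP σ (magic M) = magic (subPP σ M)
subPP σ (unpack φ M N) = unpack φ (subPP σ M) (subPP (pexts (fexts σ)) N)
subPP σ (axRep A t us M) = axRep A t us (subPP σ M)
subPP σ (axProp A t us M) = axProp A t us (subPP σ M)
subPP σ (ind φ ts M) = ind φ ts (subPP σ M)

psub0 : ∀ {n m} → PTerm n m → PSub n (suc m) m
psub0 N zero = N
psub0 N (suc i) = pvar i

_[_]P : ∀ {n m} → PTerm n (suc m) → PTerm n m → PTerm n m
M [ N ]P = subPP (psub0 N) M

_[_]FO : ∀ {n m} → PTerm (suc n) m → Term n → PTerm n m
M [ t ]FO = subP (sub0 t) M

infix 3 _⟶_

data _⟶_ {n m : ℕ} : PTerm n m → PTerm n m → Set where
  β-ƛ     : ∀ {φ M N} → app (ƛ φ M) N ⟶ M [ N ]P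
  β-Λ     : ∀ {M t} → appT (Λ M) t ⟶ M [ t ]FO
  β-fst   : ∀ {M N} → fst ⟨ M , N ⟩ ⟶ M
  β-snd   : ∀ {M N} → snd ⟨ M , N ⟩ ⟶ N
  β-inl   : ∀ {M φ N ψ O} → case (inl M) φ N ψ O ⟶ N [ M ]P
  β-inr   : ∀ {M φ N ψ O} → case (inr M) φ N ψ O ⟶ O [ M ]P
  β-let   : ∀ {φ t M N} → unpack φ (pack t M) N ⟶ (N [ t ]FO) [ M ]P
  β-ax    : ∀ {k} {A : Ax k} {t us M} → axProp A t us (axRep A t us M) ⟶ M
  β-ind   : ∀ {k} {φ : Formula (suc k)} {ts M} →
            ind φ ts M ⟶
              Λ (app (appT (renP suc M) (var zero))
                     (Λ (ƛ (var zero ∈' var (suc zero))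
                           (appT (ind φ (wkTs (wkTs ts)) (renPP suc (renP suc (renP suc M))))
                                 (var zero)))))
  ξ-appₗ   : ∀ {M M' N} → M ⟶ M' → app M N ⟶ app M' N
  ξ-appᵣ   : ∀ {M N N'} → N ⟶ N' → app M N ⟶ app M N'
  ξ-Λ      : ∀ {M M'} → M ⟶ M' → Λ M ⟶ Λ M'
  ξ-ƛ      : ∀ {φ M M'} → M ⟶ M' → ƛ φ M ⟶ ƛ φ M'
  ξ-inl    : ∀ {M M'} → M ⟶ M' → inl M ⟶ inl M'
  ξ-inr    : ∀ {M M'} → M ⟶ M' → inr M ⟶ inr M'
  ξ-fst    : ∀ {M M'} → M ⟶ M' → fst M ⟶ fst M'
  ξ-snd    : ∀ {M M'} → M ⟶ M' → snd M ⟶ snd M'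
  ξ-pack   : ∀ {t M M'} → M ⟶ M' → pack t M ⟶ pack t M'
  ξ-appT   : ∀ {M M' t} → M ⟶ M' → appT M t ⟶ appT M' t
  ξ-pairₗ  : ∀ {M M' N} → M ⟶ M' → ⟨ M , N ⟩ ⟶ ⟨ M' , N ⟩
  ξ-pairᵣ  : ∀ {M N N'} → N ⟶ N' → ⟨ M , N ⟩ ⟶ ⟨ M , N' ⟩
  ξ-case₀  : ∀ {M M' φ N ψ O} → M ⟶ M' → case M φ N ψ O ⟶ case M' φ N ψ O
  ξ-case₁  : ∀ {M φ N N' ψ O} → N ⟶ N' → case M φ N ψ O ⟶ case M φ N' ψ O
  ξ-case₂  : ∀ {M φ N ψ O O'} → O ⟶ O' → case M φ N ψ O ⟶ case M φ N ψ O'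
  ξ-magic  : ∀ {M M'} → M ⟶ M' → magic M ⟶ magic M'
  ξ-let₀   : ∀ {φ M M' N} → M ⟶ M' → unpack φ M N ⟶ unpack φ M' N
  ξ-let₁   : ∀ {φ M N N'} → N ⟶ N' → unpack φ M N ⟶ unpack φ M N'
  ξ-axRep  : ∀ {k} {A : Ax k} {t us M M'} → M ⟶ M' → axRep A t us M ⟶ axRep A t us M'
  ξ-axProp : ∀ {k} {A : Ax k} {t us M M'} → M ⟶ M' → axProp A t us M ⟶ axProp A t us M'
  ξ-ind    : ∀ {k} {φ : Formula (suc k)} {ts M M'} → M ⟶ M' → ind φ ts M ⟶ ind φ ts M'

InfiniteReduction : ∀ {n m} → PTerm n m → Set
InfiniteReduction {n} {m} M =
  Σ (ℕ → PTerm n m) λ f → (f zero ≡ M) × (∀ i → f i ⟶ f (suc i))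

infix 2 _⊢_∶_

data _⊢_∶_ {n m : ℕ} (Γ : Vec (Formula n) m) : PTerm n m → Formula n → Set where
  ⊢var   : ∀ x → Γ ⊢ pvar x ∶ lookup Γ x
  ⊢ƛ     : ∀ {φ ψ M} → (φ ∷ Γ) ⊢ M ∶ ψ → Γ ⊢ ƛ φ M ∶ φ ⇒' ψ
  ⊢app   : ∀ {φ ψ M N} → Γ ⊢ M ∶ φ ⇒' ψ → Γ ⊢ N ∶ φ → Γ ⊢ app M N ∶ ψ
  ⊢pair  : ∀ {φ ψ M N} → Γ ⊢ M ∶ φ → Γ ⊢ N ∶ ψ → Γ ⊢ ⟨ M , N ⟩ ∶ φ ∧' ψ
  ⊢fst   : ∀ {φ ψ M} → Γ ⊢ M ∶ φ ∧' ψ → Γ ⊢ fst M ∶ φ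
  ⊢snd   : ∀ {φ ψ M} → Γ ⊢ M ∶ φ ∧' ψ → Γ ⊢ snd M ∶ ψ
  ⊢inl   : ∀ {φ ψ M} → Γ ⊢ M ∶ φ → Γ ⊢ inl M ∶ φ ∨' ψ
  ⊢inr   : ∀ {φ ψ M} → Γ ⊢ M ∶ ψ → Γ ⊢ inr M ∶ φ ∨' ψ
  ⊢case  : ∀ {φ ψ ρ M N O} → Γ ⊢ M ∶ φ ∨' ψ → (φ ∷ Γ) ⊢ N ∶ ρ → (ψ ∷ Γ) ⊢ O ∶ ρ
           → Γ ⊢ case M φ N ψ O ∶ ρ
  -- ∀-intro: the bound variable is fresh for Γ (Γ is weakened)
  ⊢Λ     : ∀ {φ M} → Data.Vec.map wkF Γ ⊢ M ∶ φ → Γ ⊢ Λ M ∶ ∀' φ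
  ⊢appT  : ∀ {φ M} t → Γ ⊢ M ∶ ∀' φ → Γ ⊢ appT M t ∶ φ [ t ]F
  ⊢pack  : ∀ {φ M} t → Γ ⊢ M ∶ φ [ t ]F → Γ ⊢ pack t M ∶ ∃' φ
  -- ∃-elim: a fresh for Γ and ψ
  ⊢let   : ∀ {φ ψ M N} → Γ ⊢ M ∶ ∃' φ → (φ ∷ Data.Vec.map wkF Γ) ⊢ N ∶ wkF ψ
           → Γ ⊢ unpack φ M N ∶ ψ
  ⊢magic : ∀ {φ M} → Γ ⊢ M ∶ ⊥' → Γ ⊢ magic M ∶ φ
  ⊢axRep : ∀ {k} (A : Ax k) t us {M} → Γ ⊢ M ∶ φA A t us → Γ ⊢ axRep A t us M ∶ t ∈' tA A us
  ⊢axProp : ∀ {k} (A : Ax k) t us {M} → Γ ⊢ M ∶ t ∈' tA A us → Γ ⊢ axProp A t us M ∶ φA A t us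
  ⊢ind   : ∀ {k} (φ : Formula (suc k)) (ts : Vec (Term n) k) {M}
           → Γ ⊢ M ∶ ∀' (∀' ((var zero ∈' var (suc zero)) ⇒' subF (inst1 (var zero) (wkTs (wkTs ts))) φ)
                          ⇒' subF (inst1 (var zero) (wkTs ts)) φ)
           → Γ ⊢ ind φ ts M ∶ ∀' (subF (inst1 (var zero) (wkTs ts)) φ)

-- The reduction rule for ind reproduces an ind-redex inside its contractum,
-- under binders.  Since full reduction may contract redexes anywhere, ind can
-- be unfolded forever, so no ind-term is strongly normalizing; a typable one
-- is obtained from the induction proving ∀a. ⊥ → ⊥.
module Submission where

open import Defs
open import Data.Nat using (ℕ; zero; suc)
open import Data.Fin using (zero; suc)
open import Data.Vec using (Vec; []; _∷_)
open import Data.Product using (Σ; _×_; _,_)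
open import Relation.Binary.PropositionalEquality using (refl)

-- The contractum of  ind φ ts M  with the recursive occurrence of ind replaced by R.
indContractum : ∀ {n m} → PTerm n m → PTerm (suc (suc n)) (suc m) → PTerm n m
indContractum M R =
  Λ (app (appT (renP suc M) (var zero))
         (Λ (ƛ (var zero ∈' var (suc zero)) (appT R (var zero)))))

liftInd : ∀ {n m} → PTerm n m → PTerm (suc (suc n)) (suc m)
liftInd M = renPP suc (renP suc (renP suc M))

β-ind-contractum : ∀ {n m k} {φ : Formula (suc k)} {ts : Vec (Term n) k} {M : PTerm n m} →
                   ind φ ts M ⟶ indContractum M (ind φ (wkTs (wkTs ts)) (liftInd M))
β-ind-contractum = β-ind

indContractum-cong : ∀ {n m} {M : PTerm n m} {R R'} →
                     R ⟶ R' → indContractum M R ⟶ indContractum M R'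
indContractum-cong R⟶R' = ξ-Λ (ξ-appᵣ (ξ-Λ (ξ-ƛ (ξ-appT R⟶R'))))

indUnfolding : ℕ → ∀ {n m k} → Formula (suc k) → Vec (Term n) k → PTerm n m → PTerm n m
indUnfolding zero    φ ts M = ind φ ts M
indUnfolding (suc i) φ ts M =
  indContractum M (indUnfolding i φ (wkTs (wkTs ts)) (liftInd M))

indUnfolding-step : ∀ i {n m k} (φ : Formula (suc k)) (ts : Vec (Term n) k) (M : PTerm n m) →
                    indUnfolding i φ ts M ⟶ indUnfolding (suc i) φ ts M
indUnfolding-step zero    φ ts M = β-ind-contractum
indUnfolding-step (suc i) φ ts M =
  indContractum-cong (indUnfolding-step i φ (wkTs (wkTs ts)) (liftInd M))

ind-infiniteReduction : ∀ {n m k} (φ : Formula (suc k)) (ts : Vec (Term n) k) (M : PTerm n m) →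
                        InfiniteReduction (ind φ ts M)
ind-infiniteReduction φ ts M =
  (λ i → indUnfolding i φ ts M) , refl , (λ i → indUnfolding-step i φ ts M)

⊥⇒⊥ : ∀ {n} → Formula n
⊥⇒⊥ = ⊥' ⇒' ⊥'

indStep-⊥⇒⊥ : PTerm 0 0
indStep-⊥⇒⊥ = Λ (ƛ (∀' ((var zero ∈' var (suc zero)) ⇒' ⊥⇒⊥)) (ƛ ⊥' (pvar zero)))

⊢ind-⊥⇒⊥ : [] ⊢ ind ⊥⇒⊥ [] indStep-⊥⇒⊥ ∶ ∀' ⊥⇒⊥
⊢ind-⊥⇒⊥ = ⊢ind ⊥⇒⊥ [] (⊢Λ (⊢ƛ (⊢ƛ (⊢var zero))))

theorem6p8 : Σ ℕ λ n → Σ (Formula n) λ φ → Σ (PTerm n 0) λ M →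
    ([] ⊢ M ∶ φ) × InfiniteReduction M
theorem6p8 =
  0 , ∀' ⊥⇒⊥ , ind ⊥⇒⊥ [] indStep-⊥⇒⊥ ,
  ⊢ind-⊥⇒⊥ , ind-infiniteReduction ⊥⇒⊥ [] indStep-⊥⇒⊥
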